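{- Let $k>1$ and let $\mathcal P$ be a commensurable $k$-pattern on $\mathbb R$ whose enveloping pattern is $\mathcal A_\ell$ (the $\ell$-term arithmetic progressions). If $n$ is a positive integer and $r$ and $s$ are the remainders when $n$ is divided by $k-1$ and by $\ell-1$ respectively, then \[ \frac{(n-s)(n+s-\ell+1)}{2\ell-2}\le S_{\mathcal P}(n)\le\frac{(n-r)(n+r-k+1)}{2k-2}. \]
   Context: A direct similarity of $\mathbb R$ is a map $x\mapsto ax+b$ with $a>0$. A $k$-pattern on $\mathbb R$ is the set $\mathcal P$ of all images under direct similarities of a fixed $k$-element set $P_0\subseteq\mathbb R$; it is commensurable if $P_0$ can be taken to be a subset of $\mathbb Z$ (equivalently, all ratios of distances between points of $P_0$ are rational). For such $P_0$, its enveloping arithmetic progression is the arithmetic progression of minimum cardinality containing $P_0$; if this has $\ell$ terms, the enveloping pattern of $\mathcal P$ is $\mathcal A_\ell$, the set of all $\ell$-term arithmetic progressions $\{a,a+d,\dots,a+(\ell-1)d\}$, $d>0$. For finite $V\subseteq\mathbb R$, $S_{\mathcal P}(V)=|\{P\subseteq V:P\in\mathcal P\}|$ and $S_{\mathcal P}(n)=\max\{S_{\mathcal P}(V):|V|=n\}$. -}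

module Defs where

open import Level using (0ℓ; _⊔_) renaming (suc to lsuc)
open import Algebra.Bundles using (CommutativeRing)
open import Data.Fin using (Fin; zero; suc; toℕ)
open import Data.Integer as ℤ using (ℤ; +_; -[1+_])
open import Data.Nat as ℕ using (ℕ; zero; suc; s≤s; z≤n; NonZero; _∸_)
open import Data.Product using (∃; ∃-syntax; Σ-syntax; _×_; _,_)
open import Data.Vec.Functional using (Vector)
open import Function.Definitions using (Injective)
open import Relation.Binary using (Rel; Setoid; IsStrictTotalOrder)
open import Relation.Binary.PropositionalEquality using (_≡_)
import Relation.Binary.Construct.StrictToNonStrict as StrictToNonStrict
open import Relation.Nullary using (¬_)
open import Relation.Unary using (Pred; _∈_; _⊆_; _≐_)
open import Relation.Unary.Relation.Binary.Equality using (≐-setoid)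
import Algebra.Definitions.RawMonoid as RawMonoid

-- agda-stdlib has no real numbers, so ℝ enters as an arbitrary model of the
-- axioms that characterise it (classically) up to unique isomorphism.
-- Equality is a setoid equality, so that Cauchy reals, with excluded middle
-- supplying trichotomy and suprema, are a model.
record CompleteOrderedField : Set₁ where
  infix 4 _<_
  field
    commutativeRing : CommutativeRing 0ℓ 0ℓ

  open CommutativeRing commutativeRing public

  field
    0≉1                : ¬ (0# ≈ 1#)
    inverse            : ∀ x → ¬ (x ≈ 0#) → ∃[ y ] x * y ≈ 1#
    _<_                : Rel Carrier 0ℓ
    isStrictTotalOrder : IsStrictTotalOrder _≈_ _<_
    +-monoˡ-<          : ∀ {x y} z → x < y → x + z < y + z
    *-pos              : ∀ {x y} → 0# < x → 0# < y → 0# < x * y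

  open StrictToNonStrict _≈_ _<_ public using (_≤_)

  UpperBound : Pred Carrier 0ℓ → Pred Carrier 0ℓ
  UpperBound A u = ∀ x → x ∈ A → x ≤ u

  field
    supremum : (A : Pred Carrier 0ℓ) → ∃ A → ∃ (UpperBound A) →
               ∃[ u ] UpperBound A u × (∀ w → UpperBound A w → u ≤ w)

module Cardinality {a e} (S : Setoid a e) where
  open Setoid S

  Range : ∀ {n} → Vector Carrier n → Pred Carrier e
  Range v x = ∃[ i ] v i ≈ x

  HasCardinality : ∀ {p} → Pred Carrier p → ℕ → Set (a ⊔ e ⊔ p)
  HasCardinality A n =
    Σ[ v ∈ Vector Carrier n ] Injective _≡_ _≈_ v × A ≐ Range v

module Patterns (ℝ : CompleteOrderedField) where
  open CompleteOrderedField ℝ hiding (_≤_; zero)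
  open RawMonoid +-rawMonoid using () renaming (_×_ to _·_)
  open Cardinality setoid

  ℝ-Set : Set₁
  ℝ-Set = Pred Carrier 0ℓ

  module SetsOfSets = Cardinality (≐-setoid Carrier 0ℓ)

  fromℤ : ℤ → Carrier
  fromℤ (+ n)    = n · 1#
  fromℤ -[1+ n ] = - (suc n · 1#)

  Integers : ℝ-Set
  Integers x = ∃[ z ] fromℤ z ≈ x

  Image : (a b : Carrier) → ℝ-Set → ℝ-Set
  Image a b A y = ∃[ x ] x ∈ A × a * x + b ≈ y

  DirectlySimilarTo : ℝ-Set → Pred ℝ-Set 0ℓ
  DirectlySimilarTo P₀ P = ∃[ a ] ∃[ b ] 0# < a × P ≐ Image a b P₀

  record CommensurablePattern (k : ℕ) (𝒫 : Pred ℝ-Set 0ℓ) : Set₁ where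
    field
      P₀             : ℝ-Set
      P₀-cardinality : HasCardinality P₀ k
      P₀⊆ℤ           : P₀ ⊆ Integers
      generates      : 𝒫 ≐ DirectlySimilarTo P₀

  𝒜 : ℕ → Pred ℝ-Set 0ℓ
  𝒜 m A = ∃[ a ] ∃[ d ] 0# < d × A ≐ Range {m} (λ i → a + toℕ i · d)

  IsEnvelopingAP : ℝ-Set → ℕ → Pred ℝ-Set (lsuc 0ℓ)
  IsEnvelopingAP P₀ ℓ A =
    A ∈ 𝒜 ℓ × P₀ ⊆ A × (∀ m B → B ∈ 𝒜 m → P₀ ⊆ B → ℓ ℕ.≤ m)

  -- The enveloping pattern of 𝒫 is 𝒜 ℓ.  The value of ℓ does not depend on
  -- which integer representative P₀ of 𝒫 was chosen, since direct
  -- similarities preserve arithmetic progressions and their cardinality.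
  HasEnvelopingPattern𝒜 : ∀ {k 𝒫} → CommensurablePattern k 𝒫 → ℕ → Set₁
  HasEnvelopingPattern𝒜 c ℓ =
    ∃[ A ] IsEnvelopingAP (CommensurablePattern.P₀ c) ℓ A

  -- IsS𝒫V 𝒫 V m : S_𝒫(V) = m.
  IsS𝒫V : Pred ℝ-Set 0ℓ → ℝ-Set → ℕ → Set₁
  IsS𝒫V 𝒫 V = SetsOfSets.HasCardinality (λ P → P ⊆ V × P ∈ 𝒫)

  -- IsS𝒫 𝒫 n m : S_𝒫(n) = m, i.e. m is attained and is an upper bound.
  IsS𝒫 : Pred ℝ-Set 0ℓ → ℕ → ℕ → Set₁
  IsS𝒫 𝒫 n m =
    (∃[ V ] HasCardinality V n × IsS𝒫V 𝒫 V m) ×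
    (∀ V m′ → HasCardinality V n → IsS𝒫V 𝒫 V m′ → m′ ℕ.≤ m)

  -- Needed for division by ℓ - 1 to make sense.
  1<ℓ : ∀ {k 𝒫 ℓ} → 1 ℕ.< k → (c : CommensurablePattern k 𝒫) →
        HasEnvelopingPattern𝒜 c ℓ → 1 ℕ.< ℓ
  1<ℓ {ℓ = suc (suc _)} _ _ _ = s≤s (s≤s z≤n)
  1<ℓ {ℓ = suc zero} (s≤s (s≤s _)) c (A , (_ , _ , _ , A⊆ , _) , P₀⊆A , _)
    with CommensurablePattern.P₀-cardinality c
  ... | v , inj , _ , ran⊆ with A⊆ (P₀⊆A (ran⊆ (zero , refl)))
                              | A⊆ (P₀⊆A (ran⊆ (suc zero , refl)))
  ... | zero , p | zero , q with inj (trans (sym p) q)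
  ... | ()
  1<ℓ {ℓ = zero} (s≤s _) c (A , (_ , _ , _ , A⊆ , _) , P₀⊆A , _)
    with CommensurablePattern.P₀-cardinality c
  ... | v , inj , _ , ran⊆ with A⊆ (P₀⊆A (ran⊆ (zero , refl)))
  ... | () , _

pred-nonZero : ∀ {m} → 1 ℕ.< m → NonZero (m ∸ 1)
pred-nonZero (s≤s (s≤s _)) = _

double-pred-nonZero : ∀ {m} → 1 ℕ.< m → NonZero (2 ℕ.* (m ∸ 1))
double-pred-nonZero (s≤s (s≤s _)) = _

{-# OPTIONS --safe #-}

-- Both bounds equal a sum of quotients: ∑_{w<n} ⌊w / K⌋ with K = k - 1 above
-- and K = ℓ - 1 below.  Its terms are counted by cells (w , u) with w < n and
-- u < ⌊w / K⌋.
--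
-- Upper bound.  Cut V, in increasing order, into k - 1 consecutive blocks of
-- nearly equal size.  A copy p₀ < … < p_{k-1} of P₀ has, for some j, both p_j
-- and p_{j+1} in block j, and j and these two points determine the copy.  The
-- w-th cell column, w = j + v (k - 1), collects the pairs whose larger point
-- is the v-th point of block j.
--
-- Lower bound.  In V = {0, …, n-1} the cell (w , u) gives the ℓ-term
-- progression with last term w and difference u + 1.  It is the envelope of
-- exactly one copy of P₀, and by minimality that copy contains both ends of
-- the progression, so distinct progressions give distinct copies.

module Submission where

open import Defs
open import Level using (0ℓ) renaming (suc to lsuc)
open import Axiom.ExcludedMiddle using (ExcludedMiddle)
open import Data.Fin using (Fin; zero; suc; toℕ; fromℕ; fromℕ<; inject₁; punchOut)
import Data.Fin.Properties as Fin
open import Data.Product using (∃-syntax; _×_; _,_; proj₁; proj₂)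
open import Data.Sum using (inj₁; inj₂)
open import Data.Vec.Functional using (Vector; tail) renaming (_∷_ to _∷ᵛ_)
open import Function.Base using (_∘_)
open import Function.Definitions using (Injective)
open import Relation.Binary using (Setoid; IsStrictTotalOrder; tri<; tri≈; tri>)
open import Relation.Binary.PropositionalEquality as ≡ using (_≡_; _≢_)
open import Relation.Nullary using (Dec; yes; no; ¬_; contradiction)
open import Relation.Unary using (Pred; _∈_; _⊆_; _≐_)

-- Counting in ℕ

module Counting where
  open import Data.Nat
  open import Data.Nat.DivMod
  open import Data.Nat.Divisibility using (n∣m*n)
  open import Data.Nat.Properties
  open import Data.Nat.Tactic.RingSolver using (solve-∀)
  open ≡

  -- Sums over initial segments and their cells

  ∑< : ℕ → (ℕ → ℕ) → ℕ
  ∑< zero    f = 0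
  ∑< (suc n) f = ∑< n f + f n

  ∑<-monoˡ-≤ : ∀ f {m n} → m ≤ n → ∑< m f ≤ ∑< n f
  ∑<-monoˡ-≤ f {n = zero}  z≤n = z≤n
  ∑<-monoˡ-≤ f {n = suc n} m≤1+n with m≤n⇒m<n∨m≡n m≤1+n
  ... | inj₁ (s≤s m≤n) = ≤-trans (∑<-monoˡ-≤ f m≤n) (m≤m+n _ _)
  ... | inj₂ refl      = ≤-refl

  -- When columns are listed one after another, `∑< w f + u` is the position of the cell (w , u).
  -- This lemma and the next two make that a bijection between the cells with `w < n` and the
  -- numbers below `∑< n f`.
  cell<∑ : ∀ f {w n u} → w < n → u < f w → ∑< w f + u < ∑< n f
  cell<∑ f w<n u<fw = <-≤-trans (+-monoʳ-< _ u<fw) (∑<-monoˡ-≤ f w<n)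

  -- A cell of an earlier column comes before the start of every later column, so equal positions
  -- force equal columns; the offsets then agree by cancellation.
  cell-injective : ∀ f {w w′ u u′} → u < f w → u′ < f w′ →
                   ∑< w f + u ≡ ∑< w′ f + u′ → w ≡ w′ × u ≡ u′
  cell-injective f {w} {w′} u< u′< eq with <-cmp w w′
  ... | tri< w<w′ _ _ =
    contradiction (<-≤-trans (cell<∑ f w<w′ u<) (m≤m+n _ _)) (<-irrefl eq)
  ... | tri≈ _ refl _ = refl , +-cancelˡ-≡ (∑< w f) _ _ eq
  ... | tri> _ _ w′<w =
    contradiction (<-≤-trans (cell<∑ f w′<w u′<) (m≤m+n _ _)) (<-irrefl (sym eq))

  cell-surjective : ∀ f n {i} → i < ∑< n f →
                    ∃[ w ] ∃[ u ] w < n × u < f w × ∑< w f + u ≡ i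
  cell-surjective f (suc n) {i} i< with i <? ∑< n f
  ... | yes i<∑ = let w , u , w<n , rest = cell-surjective f n i<∑ in
                  w , u , m<n⇒m<1+n w<n , rest
  ... | no  i≮∑ = n , i ∸ ∑< n f , ≤-refl ,
    +-cancelˡ-< (∑< n f) _ _ (subst (_< _) (sym i≡) i<) , i≡
    where i≡ = m+[n∸m]≡n (≮⇒≥ i≮∑)

  -- Closed form of the sum of quotients

  module _ (K : ℕ) .{{_ : NonZero K}} where

    [j+vK]/K≡v : ∀ {j} v → j < K → (j + v * K) / K ≡ v
    [j+vK]/K≡v {j} v j<K = begin
      (j + v * K) / K   ≡⟨ +-distrib-/-∣ʳ j (n∣m*n v) ⟩
      j / K + v * K / K ≡⟨ cong₂ _+_ (m<n⇒m/n≡0 j<K) (m*n/n≡m v K) ⟩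
      v                 ∎
      where open ≡-Reasoning

    [j+vK]%K≡j : ∀ {j} v → j < K → (j + v * K) % K ≡ j
    [j+vK]%K≡j {j} v j<K = trans ([m+kn]%n≡m%n j v K) (m<n⇒m%n≡m j<K)

    -- Induction on (q , r) in lexicographic order. Allowing `r = K` lets the case (q + 1 , 0) call
    -- (q , K), which has the same upper limit of summation. The term `q * K` stands on the left to
    -- avoid subtraction in ℕ.
    2∑/ : ∀ q r → r ≤ K → 2 * ∑< (r + q * K) (_/ K) + q * K ≡ q * q * K + 2 * (q * r)
    2∑/ zero    zero    _   = refl
    2∑/ (suc q) zero    _   = begin
      2 * ∑< (K + q * K) (_/ K) + (K + q * K)     ≡⟨ rearrange (∑< (K + q * K) (_/ K)) K (q * K) ⟩
      2 * ∑< (K + q * K) (_/ K) + q * K + K       ≡⟨ cong (_+ K) (2∑/ q K ≤-refl) ⟩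
      q * q * K + 2 * (q * K) + K                 ≡⟨ expand q K ⟩
      suc q * suc q * K + 2 * (suc q * 0)         ∎
      where
      open ≡-Reasoning
      rearrange : ∀ x y z → 2 * x + (y + z) ≡ 2 * x + z + y
      rearrange = solve-∀
      expand : ∀ q K → q * q * K + 2 * (q * K) + K ≡ suc q * suc q * K + 2 * (suc q * 0)
      expand = solve-∀
    2∑/ q       (suc r) r<K = begin
      2 * (∑< (r + q * K) (_/ K) + (r + q * K) / K) + q * K
        ≡⟨ cong (λ h → 2 * (∑< (r + q * K) (_/ K) + h) + q * K) ([j+vK]/K≡v q r<K) ⟩
      2 * (∑< (r + q * K) (_/ K) + q) + q * K       ≡⟨ rearrange (∑< (r + q * K) (_/ K)) q (q * K) ⟩
      2 * ∑< (r + q * K) (_/ K) + q * K + 2 * q     ≡⟨ cong (_+ 2 * q) (2∑/ q r (<⇒≤ r<K)) ⟩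
      q * q * K + 2 * (q * r) + 2 * q               ≡⟨ expand q K r ⟩
      q * q * K + 2 * (q * suc r)                   ∎
      where
      open ≡-Reasoning
      rearrange : ∀ x y z → 2 * (x + y) + z ≡ 2 * x + z + 2 * y
      rearrange = solve-∀
      expand : ∀ q K r → q * q * K + 2 * (q * r) + 2 * q ≡ q * q * K + 2 * (q * suc r)
      expand = solve-∀

  -- A discrete intermediate value argument: walking up from index `zero`, stop at the first index
  -- where `g` falls below `s`. With block boundaries for `s`, it finds two consecutive points of a
  -- copy in one block.
  crossing : ∀ K (g s : Fin (suc K) → ℕ) →
             s zero ≤ g zero → g (fromℕ K) < s (fromℕ K) →
             ∃[ j ] s (inject₁ j) ≤ g (inject₁ j) × g (suc j) < s (suc j)
  crossing zero    g s s≤g g<s = contradiction g<s (≤⇒≯ s≤g)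
  crossing (suc K) g s s≤g g<s with g (suc zero) <? s (suc zero)
  ... | yes g₁<s₁ = zero , s≤g , g₁<s₁
  ... | no  g₁≮s₁ =
    let j , rest = crossing K (λ i → g (suc i)) (λ i → s (suc i)) (≮⇒≥ g₁≮s₁) g<s in
    suc j , rest

  -- Blocks are listed by their left ends: the first n % K of them have
  -- n / K + 1 elements, the others n / K.
  module Blocks (K : ℕ) .{{_ : NonZero K}} (n : ℕ) where

    leftEnd : ℕ → ℕ
    leftEnd j = j * (n / K) + j ⊓ (n % K)

    leftEnd-K : leftEnd K ≡ n
    leftEnd-K = begin
      K * (n / K) + K ⊓ (n % K) ≡⟨ cong₂ _+_ (*-comm K (n / K)) (m≥n⇒m⊓n≡n (m%n≤n n K)) ⟩
      n / K * K + n % K         ≡⟨ +-comm _ (n % K) ⟩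
      n % K + n / K * K         ≡⟨ m≡m%n+[m/n]*n n K ⟨
      n                         ∎
      where open ≡-Reasoning

    -- An offset `v` in block `j` is below `n / K`, or equals `n / K` when block `j` is one of the
    -- first `n % K`, the longer ones. Both cases keep `j + v * K` below `n % K + n / K * K`, which
    -- is `n`.
    block-cell : ∀ {j} v → j < K → leftEnd j + v < leftEnd (suc j) → j + v * K < n
    block-cell {j} v j<K v< with v <? n / K
    ... | yes v<q = begin-strict
      j + v * K         <⟨ +-monoˡ-< (v * K) j<K ⟩
      suc v * K         ≤⟨ *-monoˡ-≤ K v<q ⟩
      n / K * K         ≤⟨ m/n*n≤m n K ⟩
      n                 ∎
      where open ≤-Reasoning
    ... | no  v≮q with j <? n % K
    ...   | yes j<r = begin-strict
      j + v * K             <⟨ +-monoˡ-< (v * K) j<r ⟩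
      n % K + v * K         ≤⟨ +-monoʳ-≤ (n % K) (*-monoˡ-≤ K v≤q) ⟩
      n % K + n / K * K     ≡⟨ m≡m%n+[m/n]*n n K ⟨
      n                     ∎
      where
      open ≤-Reasoning
      v≤q : v ≤ n / K
      v≤q = +-cancelˡ-≤ (leftEnd j) _ _ (s≤s⁻¹ (begin-strict
        leftEnd j + v                         <⟨ v< ⟩
        n / K + j * (n / K) + suc j ⊓ (n % K) ≡⟨ cong (n / K + j * (n / K) +_) (m≤n⇒m⊓n≡m j<r) ⟩
        n / K + j * (n / K) + suc j           ≡⟨ rearrange (n / K) (j * (n / K)) j ⟩
        suc (j * (n / K) + j + n / K)         ≡⟨ cong (λ h → suc (j * (n / K) + h + n / K)) (m≤n⇒m⊓n≡m (<⇒≤ j<r)) ⟨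
        suc (leftEnd j + n / K)               ∎))
        where
        rearrange : ∀ x y z → x + y + suc z ≡ suc (y + z + x)
        rearrange = solve-∀
    ...   | no  j≮r = contradiction v<q v≮q
      where
      open ≤-Reasoning
      r≤j = ≮⇒≥ j≮r
      v<q : v < n / K
      v<q = +-cancelˡ-< (leftEnd j) _ _ (begin-strict
        leftEnd j + v                           <⟨ v< ⟩
        n / K + j * (n / K) + suc j ⊓ (n % K)   ≡⟨ cong (n / K + j * (n / K) +_) (m≥n⇒m⊓n≡n (m≤n⇒m≤1+n r≤j)) ⟩
        n / K + j * (n / K) + n % K             ≡⟨ cong (n / K + j * (n / K) +_) (m≥n⇒m⊓n≡n r≤j) ⟨
        n / K + j * (n / K) + j ⊓ (n % K)       ≡⟨ rearrange (n / K) (j * (n / K)) (j ⊓ (n % K)) ⟩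
        leftEnd j + n / K                       ∎)
        where
        rearrange : ∀ x y z → x + y + z ≡ y + z + x
        rearrange = solve-∀

    -- The number `w` packs two data: the block `w % K` and the offset `w / K` of the larger point
    -- in it; `u` is the offset of the smaller point. Hence `left` and `right` recover two
    -- consecutive values of `g` from `w` and `u` alone.
    record Slot (g : Fin (suc K) → ℕ) : Set where
      field
        w u   : ℕ
        j     : Fin K
        w<n   : w < n
        u<w/K : u < w / K
        w%K≡j : w % K ≡ toℕ j
        left  : g (inject₁ j) ≡ leftEnd (w % K) + u
        right : g (suc j) ≡ leftEnd (w % K) + w / K

    slot : ∀ g → (∀ j → g (inject₁ j) < g (suc j)) → (∀ j → g j < n) → Slot g
    slot g g-incr g<n = record
      { w     = w
      ; u     = u
      ; j     = j
      ; w<n   = block-cell v j<K (subst₂ _<_ g≡s+v refl g<s)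
      ; u<w/K = subst (u <_) (sym w/K≡v)
          (+-cancelˡ-< (leftEnd (toℕ j)) _ _ (subst₂ _<_ g≡s+u g≡s+v (g-incr j)))
      ; w%K≡j = w%K≡j
      ; left  = trans g≡s+u (cong (λ h → leftEnd h + u) (sym w%K≡j))
      ; right = trans g≡s+v (cong₂ (λ h e → leftEnd h + e) (sym w%K≡j) (sym w/K≡v))
      }
      where
      -- The first left end computes to 0, which gives `z≤n`; the end of the last block is `n`,
      -- above every value of `g`.
      cross = crossing K g (λ i → leftEnd (toℕ i)) z≤n
        (subst (g (fromℕ K) <_) (sym (trans (cong leftEnd (Fin.toℕ-fromℕ K)) leftEnd-K)) (g<n (fromℕ K)))
      j = proj₁ cross
      j<K = Fin.toℕ<n j
      s≤g : leftEnd (toℕ j) ≤ g (inject₁ j)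
      s≤g = subst (λ h → leftEnd h ≤ g (inject₁ j)) (Fin.toℕ-inject₁ j) (proj₁ (proj₂ cross))
      g<s = proj₂ (proj₂ cross)
      u = g (inject₁ j) ∸ leftEnd (toℕ j)
      v = g (suc j) ∸ leftEnd (toℕ j)
      w = toℕ j + v * K
      w/K≡v = [j+vK]/K≡v K v j<K
      w%K≡j = [j+vK]%K≡j K v j<K
      g≡s+u = sym (m+[n∸m]≡n s≤g)
      g≡s+v = sym (m+[n∸m]≡n (≤-trans s≤g (<⇒≤ (g-incr j))))

    -- Each member is coded by the position of its cell. Equal codes give equal `w` and `u`, hence
    -- the same index `j` and the same values of `g` at both points of the pair, and `separated`
    -- identifies the members.
    family-bound : ∀ {M} (g : Fin M → Fin (suc K) → ℕ) →
                   (∀ x j → g x (inject₁ j) < g x (suc j)) → (∀ x j → g x j < n) →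
                   (∀ x y j → g x (inject₁ j) ≡ g y (inject₁ j) → g x (suc j) ≡ g y (suc j) → x ≡ y) →
                   M ≤ ∑< n (_/ K)
    family-bound {M} g g-incr g<n separated = Fin.injective⇒≤ code-injective
      where
      open Slot
      sl : ∀ x → Slot (g x)
      sl x = slot (g x) (g-incr x) (g<n x)

      code : Fin M → Fin (∑< n (_/ K))
      code x = fromℕ< (cell<∑ (_/ K) (w<n (sl x)) (u<w/K (sl x)))

      code-injective : Injective _≡_ _≡_ code
      code-injective {x} {y} eq = separated x y (j (sl x))
        (begin
          g x (inject₁ (j (sl x)))            ≡⟨ left (sl x) ⟩
          leftEnd (w (sl x) % K) + u (sl x)   ≡⟨ cong₂ (λ a b → leftEnd (a % K) + b) w≡ u≡ ⟩
          leftEnd (w (sl y) % K) + u (sl y)   ≡⟨ left (sl y) ⟨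
          g y (inject₁ (j (sl y)))            ≡⟨ cong (λ i → g y (inject₁ i)) j≡ ⟨
          g y (inject₁ (j (sl x)))            ∎)
        (begin
          g x (suc (j (sl x)))                        ≡⟨ right (sl x) ⟩
          leftEnd (w (sl x) % K) + w (sl x) / K       ≡⟨ cong (λ a → leftEnd (a % K) + a / K) w≡ ⟩
          leftEnd (w (sl y) % K) + w (sl y) / K       ≡⟨ right (sl y) ⟨
          g y (suc (j (sl y)))                        ≡⟨ cong (λ i → g y (suc i)) j≡ ⟨
          g y (suc (j (sl x)))                        ∎)
        where
        open ≡-Reasoning
        same : w (sl x) ≡ w (sl y) × u (sl x) ≡ u (sl y)
        same = cell-injective (_/ K) (u<w/K (sl x)) (u<w/K (sl y)) (Fin.fromℕ<-injective _ _ _ _ eq)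
        w≡ = proj₁ same
        u≡ = proj₂ same
        j≡ : j (sl x) ≡ j (sl y)
        j≡ = Fin.toℕ-injective (trans (sym (w%K≡j (sl x))) (trans (cong (_% K) w≡) (w%K≡j (sl y))))

  -- If `j` were missed, punching it out of the codomain would inject `Fin (suc n)` into `Fin n`.
  injective⇒surjective : ∀ {n} {f : Fin n → Fin n} → Injective _≡_ _≡_ f → ∀ j → ∃[ i ] f i ≡ j
  injective⇒surjective {suc n} {f} inj j with Fin.any? (λ i → f i Fin.≟ j)
  ... | yes hit = hit
  ... | no miss = contradiction (Fin.injective⇒≤ punched-injective) 1+n≰n
    where
    j≢ : ∀ i → j ≢ f i
    j≢ i j≡ = miss (i , sym j≡)
    punched-injective : Injective _≡_ _≡_ (λ i → punchOut (j≢ i))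
    punched-injective eq = inj (Fin.punchOut-injective (j≢ _) (j≢ _) eq)

open Counting
open import Data.Nat as ℕ using (ℕ; zero; suc; z≤n; s≤s; NonZero; _∸_; _%_)

-- The bounds as sums of quotients

module Quotients where
  open import Data.Integer as ℤ using (+_; _+_; _-_; _*_)
  import Data.Integer.Properties as ℤ
  open import Data.Integer.Tactic.RingSolver using (solve-∀)
  open import Data.Nat.DivMod using (m≡m%n+[m/n]*n; m%n≤n)
  open import Data.Rational as ℚ using (_/_; _≤_)
  import Data.Rational.Properties as ℚ
  import Data.Rational.Unnormalised as ℚᵘ
  import Data.Rational.Unnormalised.Properties as ℚᵘ
  open ≡

  /1-mono-≤ : ∀ {m n} → m ℕ.≤ n → + m / 1 ≤ + n / 1
  /1-mono-≤ {m} {n} m≤n = ℚ.toℚᵘ-cancel-≤ (ℚᵘ.≤-respˡ-≃ (ℚᵘ.≃-sym (ℚ.toℚᵘ-fromℚᵘ (ℚᵘ.mkℚᵘ (+ m) 0)))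
    (ℚᵘ.≤-respʳ-≃ (ℚᵘ.≃-sym (ℚ.toℚᵘ-fromℚᵘ (ℚᵘ.mkℚᵘ (+ n) 0)))
     (ℚᵘ.*≤* (ℤ.*-monoʳ-≤-nonNeg (+ 1) (ℤ.+≤+ m≤n)))))

  [m*n]/n≡m/1 : ∀ m n .{{_ : NonZero n}} → (m * + n) / n ≡ m / 1
  [m*n]/n≡m/1 m (suc n) = ℚ.fromℚᵘ-cong {ℚᵘ.mkℚᵘ (m * + suc n) n} {ℚᵘ.mkℚᵘ m 0}
    (ℚᵘ.*≡* (ℤ.*-identityʳ _))

  -- With `n = r + q K` the numerator is `K (q² K + 2 q r - q K)`. By `2∑/` the second factor is
  -- twice the sum, so the division by `2 K` is exact.
  [n-r][n+r-K]/2K≡∑ : ∀ K n .{{_ : NonZero K}} .{{_ : NonZero (2 ℕ.* K)}} →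
    ((+ n - + (n % K)) * (+ n + + (n % K) - + suc K + + 1)) / (2 ℕ.* K) ≡ + ∑< n (ℕ._/ K) / 1
  [n-r][n+r-K]/2K≡∑ K n = trans (ℚ./-cong {q₁ = 2 ℕ.* K} numerator refl) ([m*n]/n≡m/1 (+ S) (2 ℕ.* K))
    where
    open ≡-Reasoning
    q = n ℕ./ K
    r = n % K
    S = ∑< n (ℕ._/ K)
    n≡ : n ≡ r ℕ.+ q ℕ.* K
    n≡ = m≡m%n+[m/n]*n n K
    n≡ᶻ : + n ≡ + r + + q * + K
    n≡ᶻ = trans (cong +_ n≡) (trans (ℤ.pos-+ r _) (cong (λ h → + r + h) (ℤ.pos-* q K)))
    closed : + 2 * + S + + q * + K ≡ + q * + q * + K + + 2 * (+ q * + r)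
    closed = begin
      + 2 * + S + + q * + K ≡⟨ cong₂ _+_ (ℤ.pos-* 2 S) (ℤ.pos-* q K) ⟨
      + (2 ℕ.* S) + + (q ℕ.* K) ≡⟨ ℤ.pos-+ (2 ℕ.* S) (q ℕ.* K) ⟨
      + (2 ℕ.* S ℕ.+ q ℕ.* K) ≡⟨ cong (λ h → + (2 ℕ.* ∑< h (ℕ._/ K) ℕ.+ q ℕ.* K)) n≡ ⟩
      + (2 ℕ.* ∑< (r ℕ.+ q ℕ.* K) (ℕ._/ K) ℕ.+ q ℕ.* K) ≡⟨ cong +_ (2∑/ K q r (m%n≤n n K)) ⟩
      + (q ℕ.* q ℕ.* K ℕ.+ 2 ℕ.* (q ℕ.* r)) ≡⟨ ℤ.pos-+ (q ℕ.* q ℕ.* K) (2 ℕ.* (q ℕ.* r)) ⟩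
      + (q ℕ.* q ℕ.* K) + + (2 ℕ.* (q ℕ.* r)) ≡⟨ cong₂ _+_ (ℤ.pos-* (q ℕ.* q) K) (ℤ.pos-* 2 (q ℕ.* r)) ⟩
      + (q ℕ.* q) * + K + + 2 * + (q ℕ.* r) ≡⟨ cong₂ (λ a b → a * + K + + 2 * b) (ℤ.pos-* q q) (ℤ.pos-* q r) ⟩
      + q * + q * + K + + 2 * (+ q * + r) ∎
    expand : ∀ r q K → (r + q * K - r) * (r + q * K + r - (+ 1 + K) + + 1)
                     ≡ K * ((q * q * K + + 2 * (q * r)) - q * K)
    expand = solve-∀
    collect : ∀ S q K → K * ((+ 2 * S + q * K) - q * K) ≡ S * (+ 2 * K)
    collect = solve-∀
    numerator : (+ n - + r) * (+ n + + r - + suc K + + 1) ≡ + S * + (2 ℕ.* K)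
    numerator = begin
      (+ n - + r) * (+ n + + r - + suc K + + 1)
        ≡⟨ cong (λ h → (h - + r) * (h + + r - + suc K + + 1)) n≡ᶻ ⟩
      (+ r + + q * + K - + r) * (+ r + + q * + K + + r - (+ 1 + + K) + + 1)
        ≡⟨ expand (+ r) (+ q) (+ K) ⟩
      + K * ((+ q * + q * + K + + 2 * (+ q * + r)) - + q * + K)
        ≡⟨ cong (λ h → + K * (h - + q * + K)) closed ⟨
      + K * ((+ 2 * + S + + q * + K) - + q * + K)
        ≡⟨ collect (+ S) (+ q) (+ K) ⟩
      + S * (+ 2 * + K)
        ≡⟨ cong (λ h → + S * h) (ℤ.pos-* 2 K) ⟨
      + S * + (2 ℕ.* K) ∎

open Quotients
import Algebra.Definitions.RawMonoid as RawMonoid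
import Algebra.Properties.Group as GroupProperties
import Algebra.Properties.Ring as RingProperties
import Algebra.Properties.Semiring.Mult as SemiringMult
import Data.Nat.DivMod as ℕ
import Data.Nat.Properties as ℕ
open import Level using (Lift; lift; lower)
open import Relation.Nullary.Decidable using (map′; decidable-stable)
open import Relation.Unary.Properties using (≐-refl; ≐-sym; ≐-trans)
open import Relation.Unary.Relation.Binary.Equality using (≐-setoid)

-- Maximal finite families, by excluded middle

module Classical (em : ExcludedMiddle (lsuc 0ℓ)) where

  em₀ : ExcludedMiddle 0ℓ
  em₀ {P} = map′ lower lift (em {Lift (lsuc 0ℓ) P})

  -- Excluded middle decides whether a value above the current one satisfies `Q`. Each move upwards
  -- shrinks the gap to `B`, which serves as fuel for the recursion.
  maximum : (Q : ℕ → Set₁) (B : ℕ) → (∀ m → Q m → m ℕ.≤ B) → ∀ {m₀} → Q m₀ →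
            ∃[ m ] m₀ ℕ.≤ m × Q m × (∀ m′ → Q m′ → m′ ℕ.≤ m)
  maximum Q B bounded {m₀} = go (B ∸ m₀) ℕ.≤-refl
    where
    go : ∀ fuel {m₀} → B ∸ m₀ ℕ.≤ fuel → Q m₀ →
         ∃[ m ] m₀ ℕ.≤ m × Q m × (∀ m′ → Q m′ → m′ ℕ.≤ m)
    go fuel {m₀} fuel≥ q with em {∃[ m ] m₀ ℕ.< m × Q m}
    ... | no none = m₀ , ℕ.≤-refl , q , λ m′ q′ → ℕ.≮⇒≥ (λ m₀<m′ → none (m′ , m₀<m′ , q′))
    go zero {m₀} fuel≥ q | yes (m , m₀<m , q′) =
      contradiction (ℕ.<-≤-trans m₀<m (bounded m q′)) (ℕ.≤⇒≯ (ℕ.m∸n≡0⇒m≤n (ℕ.n≤0⇒n≡0 fuel≥)))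
    go (suc fuel) {m₀} fuel≥ q | yes (m , m₀<m , q′) =
      let m* , m≤ , rest = go fuel fuel≥′ q′ in m* , ℕ.≤-trans (ℕ.<⇒≤ m₀<m) m≤ , rest
      where
      fuel≥′ : B ∸ m ℕ.≤ fuel
      fuel≥′ = ℕ.s≤s⁻¹ (ℕ.<-≤-trans (ℕ.∸-monoʳ-< m₀<m (bounded m q′)) fuel≥)

  module _ (S : Setoid (lsuc 0ℓ) 0ℓ) where
    open Setoid S
    open Cardinality S

    ∷-injective : ∀ {m x} {v : Vector Carrier m} → Injective _≡_ _≈_ v → ¬ Range v x →
                  Injective _≡_ _≈_ (x ∷ᵛ v)
    ∷-injective v-inj x∉v {zero}  {zero}  _  = ≡.refl
    ∷-injective v-inj x∉v {zero}  {suc j} eq = contradiction (j , sym eq) x∉v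
    ∷-injective v-inj x∉v {suc i} {zero}  eq = contradiction (i , eq) x∉v
    ∷-injective v-inj x∉v {suc i} {suc j} eq = ≡.cong suc (v-inj eq)

    -- An injective family in `C` of greatest size exhausts `C`, since a missed element could be
    -- prepended to it. This produces the full list of copies inside a set, which `HasCardinality`
    -- demands, from a bound on partial lists alone.
    extend-to-enumeration :
      (C : Pred Carrier 0ℓ) → (∀ {x y} → x ≈ y → C x → C y) →
      (B : ℕ) → (∀ {m} (v : Vector Carrier m) → Injective _≡_ _≈_ v → (∀ i → C (v i)) → m ℕ.≤ B) →
      ∀ {m₀} (v : Vector Carrier m₀) → Injective _≡_ _≈_ v → (∀ i → C (v i)) →
      ∃[ m ] m₀ ℕ.≤ m × HasCardinality C m
    extend-to-enumeration C C-resp B bounded {m₀} v₀ inj₀ C₀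
      with maximum Family B (λ _ (v , inj , Cv) → bounded v inj Cv) (v₀ , inj₀ , C₀)
      where
      Family : ℕ → Set₁
      Family m = ∃[ v ] Injective {A = Fin m} _≡_ _≈_ v × (∀ i → C (v i))
    ... | m , m₀≤m , (v , inj , Cv) , max = m , m₀≤m , v , inj , C⊆ , λ { (i , vi≈x) → C-resp vi≈x (Cv i) }
      where
      C⊆ : C ⊆ Range v
      C⊆ {x} Cx = decidable-stable em₀ λ x∉v →
        ℕ.1+n≰n (max (suc m) (x ∷ᵛ v , ∷-injective inj x∉v , λ { zero → Cx ; (suc i) → Cv i }))

-- Order and ranks in the field

indicator : {P : Set} → Dec P → ℕ
indicator (yes _) = 1
indicator (no  _) = 0

indicator-mono : {P Q : Set} (P? : Dec P) (Q? : Dec Q) → (P → Q) → indicator P? ℕ.≤ indicator Q?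
indicator-mono (yes _) (yes _) _   = ℕ.≤-refl
indicator-mono (yes p) (no ¬q) imp = contradiction (imp p) ¬q
indicator-mono (no _)  _       _   = z≤n

indicator-strict : {P Q : Set} (P? : Dec P) (Q? : Dec Q) → ¬ P → Q → indicator P? ℕ.< indicator Q?
indicator-strict (yes p) _       ¬p _ = contradiction p ¬p
indicator-strict (no _)  (yes _) _  _ = ℕ.≤-refl
indicator-strict (no _)  (no ¬q) _  q = contradiction q ¬q

indicator≤1 : {P : Set} (P? : Dec P) → indicator P? ℕ.≤ 1
indicator≤1 (yes _) = ℕ.≤-refl
indicator≤1 (no _)  = z≤n

module OrderedField (ℝ : CompleteOrderedField) where
  open CompleteOrderedField ℝ hiding (_≤_; zero)
  open IsStrictTotalOrder isStrictTotalOrder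
    using (compare; _<?_; irrefl; <-resp-≈) renaming (trans to <-trans; asym to <-asym)
  open GroupProperties +-group using (∙-cancelˡ; ∙-cancelʳ; ⁻¹-involutive)
  open RingProperties ring using (-‿distribˡ-*)
  open RawMonoid +-rawMonoid using () renaming (_×_ to _·_)
  open Cardinality setoid
  open import Relation.Binary.Reasoning.Setoid setoid

  <-respˡ : ∀ {x y z} → x ≈ y → x < z → y < z
  <-respˡ = proj₂ <-resp-≈

  <-respʳ : ∀ {x y z} → x ≈ y → z < x → z < y
  <-respʳ = proj₁ <-resp-≈

  x<y⇒0<y-x : ∀ {x y} → x < y → 0# < y - x
  x<y⇒0<y-x {x} x<y = <-respˡ (-‿inverseʳ x) (+-monoˡ-< (- x) x<y)

  y-x+x≈y : ∀ x y → (y - x) + x ≈ y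
  y-x+x≈y x y = trans (+-assoc y (- x) x) (trans (+-congˡ (-‿inverseˡ x)) (+-identityʳ y))

  x<0⇒0<-x : ∀ {x} → x < 0# → 0# < - x
  x<0⇒0<-x {x} x<0 = <-respʳ (+-identityˡ (- x)) (x<y⇒0<y-x x<0)

  0<1 : 0# < 1#
  0<1 with compare 0# 1#
  ... | tri< 0<1 _ _ = 0<1
  ... | tri≈ _ 0≈1 _ = contradiction 0≈1 0≉1
  ... | tri> _ _ 1<0 = <-respʳ -1*-1≈1 (*-pos 0<-1 0<-1)
    where
    0<-1 = x<0⇒0<-x 1<0
    -1*-1≈1 : - 1# * - 1# ≈ 1#
    -1*-1≈1 = begin
      - 1# * - 1#   ≈⟨ -‿distribˡ-* 1# (- 1#) ⟨
      - (1# * - 1#) ≈⟨ -‿cong (*-identityˡ (- 1#)) ⟩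
      - - 1#        ≈⟨ ⁻¹-involutive 1# ⟩
      1#            ∎

  *-monoʳ-< : ∀ {a x y} → 0# < a → x < y → a * x < a * y
  *-monoʳ-< {a} {x} {y} 0<a x<y = <-respˡ (+-identityˡ _) (<-respʳ eq
    (+-monoˡ-< (a * x) (*-pos 0<a (x<y⇒0<y-x x<y))))
    where
    eq : a * (y - x) + a * x ≈ a * y
    eq = trans (sym (distribˡ a (y - x) x)) (*-congˡ (y-x+x≈y x y))

  positive-inverse : ∀ {x} → 0# < x → ∃[ y ] 0# < y × x * y ≈ 1#
  positive-inverse {x} 0<x with inverse x (λ x≈0 → irrefl (sym x≈0) 0<x)
  ... | y , xy≈1 with compare 0# y
  ...   | tri< 0<y _ _ = y , 0<y , xy≈1
  ...   | tri≈ _ 0≈y _ = contradiction (trans (sym (zeroʳ x)) (trans (*-congˡ 0≈y) xy≈1)) 0≉1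
  ...   | tri> _ _ y<0 = contradiction (<-respʳ (zeroʳ x) (<-respˡ xy≈1 (*-monoʳ-< 0<x y<0))) (<-asym 0<1)

  affine-< : ∀ {a x y} b → 0# < a → x < y → a * x + b < a * y + b
  affine-< b 0<a x<y = +-monoˡ-< b (*-monoʳ-< 0<a x<y)

  -- Comparing the two equations leaves `a * d ≈ a′ * d` for `d = y - x`, which is positive and so
  -- invertible. Thus a copy is determined by the images of two points of the pattern.
  affine-unique : ∀ {a b a′ b′ x y} → x < y →
                  a * x + b ≈ a′ * x + b′ → a * y + b ≈ a′ * y + b′ → a ≈ a′ × b ≈ b′
  affine-unique {a} {b} {a′} {b′} {x} {y} x<y eqˣ eqʸ = a≈a′ , b≈b′
    where
    d = y - x
    d⁻¹ = positive-inverse (x<y⇒0<y-x x<y)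
    i = proj₁ d⁻¹
    di≈1 = proj₂ (proj₂ d⁻¹)
    split : ∀ a b → a * y + b ≈ a * d + (a * x + b)
    split a b = begin
      a * y + b             ≈⟨ +-congʳ (*-congˡ (y-x+x≈y x y)) ⟨
      a * (d + x) + b       ≈⟨ +-congʳ (distribˡ a d x) ⟩
      (a * d + a * x) + b   ≈⟨ +-assoc _ _ _ ⟩
      a * d + (a * x + b)   ∎
    ad≈a′d : a * d ≈ a′ * d
    ad≈a′d = ∙-cancelʳ (a * x + b) _ _ (begin
      a * d + (a * x + b)     ≈⟨ split a b ⟨
      a * y + b               ≈⟨ eqʸ ⟩
      a′ * y + b′             ≈⟨ split a′ b′ ⟩
      a′ * d + (a′ * x + b′)  ≈⟨ +-congˡ eqˣ ⟨
      a′ * d + (a * x + b)    ∎)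
    undo : ∀ a → a * d * i ≈ a
    undo a = trans (*-assoc a d i) (trans (*-congˡ di≈1) (*-identityʳ a))
    a≈a′ : a ≈ a′
    a≈a′ = trans (sym (undo a)) (trans (*-congʳ ad≈a′d) (undo a′))
    b≈b′ : b ≈ b′
    b≈b′ = ∙-cancelˡ (a * x) _ _ (trans eqˣ (+-congʳ (*-congʳ (sym a≈a′))))

  ι : ℕ → Carrier
  ι n = n · 1#

  ιn<ι[1+n] : ∀ n → ι n < ι (suc n)
  ιn<ι[1+n] n = <-respˡ (+-identityˡ _) (+-monoˡ-< (ι n) 0<1)

  ι-mono-< : ∀ {m n} → m ℕ.< n → ι m < ι n
  ι-mono-< {n = suc n} m<1+n with ℕ.m≤n⇒m<n∨m≡n (ℕ.s≤s⁻¹ m<1+n)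
  ... | inj₁ m<n    = <-trans (ι-mono-< m<n) (ιn<ι[1+n] n)
  ... | inj₂ ≡.refl = ιn<ι[1+n] n

  ι-injective : Injective _≡_ _≈_ ι
  ι-injective {m} {n} eq with ℕ.<-cmp m n
  ... | tri< m<n _ _ = contradiction (ι-mono-< m<n) (irrefl eq)
  ... | tri≈ _ m≡n _ = m≡n
  ... | tri> _ _ n<m = contradiction (ι-mono-< n<m) (irrefl (sym eq))

  -- For distinct entries, the rank of an entry is its position in increasing order, counted from 0.
  -- It is read off the enumeration without sorting it.
  rank : ∀ {n} → Vector Carrier n → Carrier → ℕ
  rank {zero}  v x = 0
  rank {suc n} v x = indicator (v zero <? x) ℕ.+ rank (tail v) x

  rank-mono : ∀ {n x y} (v : Vector Carrier n) → x < y → rank v x ℕ.≤ rank v y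
  rank-mono {zero}  v x<y = z≤n
  rank-mono {suc n} v x<y =
    ℕ.+-mono-≤ (indicator-mono (v zero <? _) (v zero <? _) (λ v<x → <-trans v<x x<y)) (rank-mono (tail v) x<y)

  -- The entry equal to `x` is counted for `y` but not for `x`.
  rank-strict : ∀ {n x y} (v : Vector Carrier n) → Range v x → x < y → rank v x ℕ.< rank v y
  rank-strict {suc n} v (zero , v≈x) x<y =
    ℕ.+-mono-<-≤ (indicator-strict (v zero <? _) (v zero <? _) (irrefl v≈x) (<-respˡ (sym v≈x) x<y))
      (rank-mono (tail v) x<y)
  rank-strict {suc n} v (suc i , v≈x) x<y =
    ℕ.+-mono-≤-< (indicator-mono (v zero <? _) (v zero <? _) (λ v<x → <-trans v<x x<y))
      (rank-strict (tail v) (i , v≈x) x<y)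

  rank≤n : ∀ {n} (v : Vector Carrier n) x → rank v x ℕ.≤ n
  rank≤n {zero}  v x = z≤n
  rank≤n {suc n} v x = ℕ.+-mono-≤ (indicator≤1 (v zero <? x)) (rank≤n (tail v) x)

  rank<n : ∀ {n x} (v : Vector Carrier n) → Range v x → rank v x ℕ.< n
  rank<n {suc n} {x} v (zero , v≈x) =
    -- The second decision is `yes` outright, so its indicator is 1: the entry equal to `x`
    -- contributes 0 out of a possible 1.
    ℕ.+-mono-<-≤ (indicator-strict (v zero <? x) (yes v≈x) (irrefl v≈x) v≈x) (rank≤n (tail v) x)
  rank<n {suc n} {x} v (suc i , v≈x) =
    ℕ.+-mono-≤-< (indicator≤1 (v zero <? x)) (rank<n (tail v) (i , v≈x))

  rank-injective : ∀ {n x y} (v : Vector Carrier n) → Range v x → Range v y →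
                   rank v x ≡ rank v y → x ≈ y
  rank-injective {x = x} {y} v x∈v y∈v eq with compare x y
  ... | tri< x<y _ _ = contradiction (rank-strict v x∈v x<y) (ℕ.<-irrefl eq)
  ... | tri≈ _ x≈y _ = x≈y
  ... | tri> _ _ y<x = contradiction (rank-strict v y∈v y<x) (ℕ.<-irrefl (≡.sym eq))

  -- Ranks map `Fin n` injectively to itself, so every rank occurs; `t i` is the entry of rank `i`.
  sorted-enumeration : ∀ {n} (v : Vector Carrier n) → Injective _≡_ _≈_ v →
                       ∃[ t ] (∀ {i j : Fin n} → toℕ i ℕ.< toℕ j → t i < t j) × (∀ i → Range v (t i))
  sorted-enumeration {n} v v-inj = t , t-mono , λ i → proj₁ (index i) , refl
    where
    ρ : Fin n → Fin n
    ρ i = fromℕ< (rank<n v (i , refl))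
    ρ-inj : Injective _≡_ _≡_ ρ
    ρ-inj {i} {j} eq = v-inj (rank-injective v (i , refl) (j , refl) (Fin.fromℕ<-injective _ _ _ _ eq))
    index = injective⇒surjective ρ-inj
    t : Fin n → Carrier
    t i = v (proj₁ (index i))
    rank-t : ∀ i → rank v (t i) ≡ toℕ i
    rank-t i = ≡.trans (≡.sym (Fin.toℕ-fromℕ< _)) (≡.cong toℕ (proj₂ (index i)))
    t-mono : ∀ {i j} → toℕ i ℕ.< toℕ j → t i < t j
    t-mono {i} {j} i<j with compare (t i) (t j)
    ... | tri< ti<tj _ _ = ti<tj
    ... | tri≈ _ ti≈tj _ = contradiction i<j (ℕ.<-irrefl (≡.trans (≡.sym (rank-t i))
      (≡.trans (≡.cong (λ k → rank v (v k)) (v-inj ti≈tj)) (rank-t j))))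
    ... | tri> _ _ tj<ti = contradiction i<j (ℕ.<-asym
      (≡.subst₂ ℕ._<_ (rank-t j) (rank-t i) (rank-strict v (proj₁ (index j) , refl) tj<ti)))

-- Copies of a pattern in a finite set

module PatternCounts (em : ExcludedMiddle (lsuc 0ℓ)) (ℝ : CompleteOrderedField) where
  open CompleteOrderedField ℝ hiding (_≤_; zero)
  open SemiringMult semiring using (×-comm-*; ×-assocˡ; ×-congʳ; ×-homo-+)
  open RawMonoid +-rawMonoid using () renaming (_×_ to _·_)
  open Cardinality setoid
  open Patterns ℝ
  open OrderedField ℝ
  open Classical em

  cardinality-resp : ∀ {A : ℝ-Set} {n x y} → HasCardinality A n → x ≈ y → x ∈ A → y ∈ A
  cardinality-resp (_ , _ , A⊆ , ⊆A) x≈y x∈A with A⊆ x∈A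
  ... | i , vi≈x = ⊆A (i , trans vi≈x x≈y)

  Image-cong : ∀ {A : ℝ-Set} {a a′ b b′} → a ≈ a′ → b ≈ b′ → Image a b A ⊆ Image a′ b′ A
  Image-cong a≈ b≈ (x , x∈A , eq) = x , x∈A , trans (sym (+-cong (*-congʳ a≈) b≈)) eq

  module _ {k 𝒫} (c : CommensurablePattern k 𝒫) where
    open CommensurablePattern c

    𝒫-resp : ∀ {P Q} → P ≐ Q → P ∈ 𝒫 → Q ∈ 𝒫
    𝒫-resp P≐Q P∈𝒫 with proj₁ generates P∈𝒫
    ... | a , b , 0<a , P≐ = proj₂ generates (a , b , 0<a , ≐-trans (≐-sym P≐Q) P≐)

    P₀-resp : ∀ {x y} → x ≈ y → x ∈ P₀ → y ∈ P₀
    P₀-resp = cardinality-resp P₀-cardinality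

    -- Otherwise dropping the first term would leave a progression of `L` terms that still contains
    -- `P₀`, against minimality.
    envelope-first : ∀ {L A} → (env : IsEnvelopingAP P₀ (suc L) A) →
                     let (α , δ , _) = proj₁ env in α ∈ P₀
    envelope-first {L} ((α , δ , 0<δ , A⊆ , _) , P₀⊆A , minimal) with em₀ {α ∈ P₀}
    ... | yes α∈P₀ = α∈P₀
    ... | no  α∉P₀ = contradiction (minimal L B (α + δ , δ , 0<δ , ≐-refl) P₀⊆B) ℕ.1+n≰n
      where
      B : ℝ-Set
      B = Range {L} (λ i → (α + δ) + toℕ i · δ)
      P₀⊆B : P₀ ⊆ B
      P₀⊆B x∈P₀ with A⊆ (P₀⊆A x∈P₀)
      ... | zero  , eq = contradiction (P₀-resp (trans (sym eq) (+-identityʳ α)) x∈P₀) α∉P₀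
      ... | suc i , eq = i , trans (+-assoc α δ _) eq

    -- The same argument at the other end: without its last term, the progression would be too
    -- short.
    envelope-last : ∀ {L A} → (env : IsEnvelopingAP P₀ (suc L) A) →
                    let (α , δ , _) = proj₁ env in α + L · δ ∈ P₀
    envelope-last {L} ((α , δ , 0<δ , A⊆ , _) , P₀⊆A , minimal) with em₀ {α + L · δ ∈ P₀}
    ... | yes ω∈P₀ = ω∈P₀
    ... | no  ω∉P₀ = contradiction (minimal L B (α , δ , 0<δ , ≐-refl) P₀⊆B) ℕ.1+n≰n
      where
      B : ℝ-Set
      B = Range {L} (λ i → α + toℕ i · δ)
      P₀⊆B : P₀ ⊆ B
      P₀⊆B {x} x∈P₀ with A⊆ (P₀⊆A x∈P₀)
      ... | i , eq with toℕ i ℕ.≟ L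
      ...   | yes i≡L = contradiction
        (P₀-resp (trans (sym eq) (reflexive (≡.cong (λ m → α + m · δ) i≡L))) x∈P₀) ω∉P₀
      ...   | no  i≢L = fromℕ< i<L ,
        trans (reflexive (≡.cong (λ m → α + m · δ) (Fin.toℕ-fromℕ< i<L))) eq
        where i<L = ℕ.≤∧≢⇒< (Fin.toℕ≤pred[n] i) i≢L

    -- The copy of P₀ whose enveloping progression is a, a + d, …, a + L d.
    placement : ∀ {L A} → IsEnvelopingAP P₀ (suc L) A → ∀ a {d} → 0 ℕ.< d →
      ∃[ P ] P ∈ 𝒫
           × (∀ {y} → y ∈ P → ∃[ i ] i ℕ.≤ L × ι (a ℕ.+ i ℕ.* d) ≈ y)
           × ι (a ℕ.+ 0 ℕ.* d) ∈ P × ι (a ℕ.+ L ℕ.* d) ∈ P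
    placement {L} env@((α , δ , 0<δ , A⊆ , _) , P₀⊆A , _) a {d} 0<d =
        Image s t P₀
      , proj₂ generates (s , t , *-pos (ι-mono-< 0<d) 0<δ⁻¹ , ≐-refl)
      , contained
      , (α , envelope-first env , trans (+-congʳ (*-congˡ (sym (+-identityʳ α)))) (placed 0))
      , (α + L · δ , envelope-last env , placed L)
      where
      open import Relation.Binary.Reasoning.Setoid setoid
      δ-inverse = positive-inverse 0<δ
      δ⁻¹ = proj₁ δ-inverse
      0<δ⁻¹ = proj₁ (proj₂ δ-inverse)
      δδ⁻¹≈1 = proj₂ (proj₂ δ-inverse)
      -- The scale `s` turns the difference `δ` into `d`, and the shift `t` then sends `α` to `a`.
      s = ι d * δ⁻¹
      t = ι a - s * α

      sδ≈d : s * δ ≈ ι d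
      sδ≈d = begin
        ι d * δ⁻¹ * δ     ≈⟨ *-assoc (ι d) δ⁻¹ δ ⟩
        ι d * (δ⁻¹ * δ)   ≈⟨ *-congˡ (trans (*-comm δ⁻¹ δ) δδ⁻¹≈1) ⟩
        ι d * 1#          ≈⟨ *-identityʳ (ι d) ⟩
        ι d               ∎

      placed : ∀ i → s * (α + i · δ) + t ≈ ι (a ℕ.+ i ℕ.* d)
      placed i = begin
        s * (α + i · δ) + (ι a - s * α)         ≈⟨ +-congʳ (distribˡ s α (i · δ)) ⟩
        (s * α + s * (i · δ)) + (ι a - s * α)   ≈⟨ +-comm _ _ ⟩
        (ι a - s * α) + (s * α + s * (i · δ))   ≈⟨ +-assoc _ _ _ ⟨
        (ι a - s * α) + s * α + s * (i · δ)     ≈⟨ +-cong (y-x+x≈y (s * α) (ι a)) (×-comm-* i s δ) ⟩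
        ι a + i · (s * δ)                       ≈⟨ +-congˡ (×-congʳ i sδ≈d) ⟩
        ι a + i · (d · 1#)                      ≈⟨ +-congˡ (×-assocˡ 1# i d) ⟩
        ι a + ι (i ℕ.* d)                       ≈⟨ ×-homo-+ 1# a (i ℕ.* d) ⟨
        ι (a ℕ.+ i ℕ.* d)                       ∎

      contained : ∀ {y} → y ∈ Image s t P₀ → ∃[ i ] i ℕ.≤ L × ι (a ℕ.+ i ℕ.* d) ≈ y
      contained (x , x∈P₀ , eq) with A⊆ (P₀⊆A x∈P₀)
      ... | i , x≈ = toℕ i , Fin.toℕ≤pred[n] i ,
        trans (sym (placed (toℕ i))) (trans (+-congʳ (*-congˡ x≈)) eq)

    -- Lower bound: copies inside an initial segment

    initialSegment : ℕ → ℝ-Set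
    initialSegment n = Range {n} (λ i → ι (toℕ i))

    lower-family : ∀ {L A} .{{_ : NonZero L}} → IsEnvelopingAP P₀ (suc L) A → ∀ n →
      ∃[ P ] Injective {A = Fin (∑< n (ℕ._/ L))} _≡_ _≐_ P × (∀ x → P x ⊆ initialSegment n × P x ∈ 𝒫)
    lower-family {L} env n = P , P-injective , λ x → P⊆V x , P∈𝒫 x
      where
      cell : ∀ x → ∃[ w ] ∃[ u ] w ℕ.< n × u ℕ.< w ℕ./ L × ∑< w (ℕ._/ L) ℕ.+ u ≡ toℕ x
      cell x = cell-surjective (ℕ._/ L) n (Fin.toℕ<n x)
      w u a : Fin (∑< n (ℕ._/ L)) → ℕ
      w x = proj₁ (cell x)
      u x = proj₁ (proj₂ (cell x))
      -- The truncated subtraction is exact: `u < w / L` gives `L * (u + 1) ≤ w`. The progression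
      -- therefore starts in ℕ and ends at `w`.
      a x = w x ∸ L ℕ.* suc (u x)
      w<n : ∀ x → w x ℕ.< n
      w<n x = proj₁ (proj₂ (proj₂ (cell x)))
      a+Ld≡w : ∀ x → a x ℕ.+ L ℕ.* suc (u x) ≡ w x
      a+Ld≡w x = ℕ.m∸n+n≡m (ℕ.≤-trans
        (ℕ.≤-trans (ℕ.≤-reflexive (ℕ.*-comm L (suc (u x))))
          (ℕ.*-monoˡ-≤ L (proj₁ (proj₂ (proj₂ (proj₂ (cell x)))))))
        (ℕ.m/n*n≤m (w x) L))

      place : ∀ x → _
      place x = placement env (a x) {suc (u x)} (s≤s z≤n)
      P : Vector ℝ-Set _
      P x = proj₁ (place x)
      P∈𝒫 : ∀ x → P x ∈ 𝒫
      P∈𝒫 x = proj₁ (proj₂ (place x))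
      a∈P : ∀ x → ι (a x) ∈ P x
      a∈P x = ≡.subst (λ m → ι m ∈ P x) (ℕ.+-identityʳ (a x)) (proj₁ (proj₂ (proj₂ (proj₂ (place x)))))
      w∈P : ∀ x → ι (w x) ∈ P x
      w∈P x = ≡.subst (λ m → ι m ∈ P x) (a+Ld≡w x) (proj₂ (proj₂ (proj₂ (proj₂ (place x)))))

      within : ∀ x {y} → y ∈ P x → ∃[ m ] a x ℕ.≤ m × m ℕ.≤ w x × ι m ≈ y
      within x y∈P =
        let i , i≤L , eq = proj₁ (proj₂ (proj₂ (place x))) y∈P in
        a x ℕ.+ i ℕ.* suc (u x) , ℕ.m≤m+n (a x) _ ,
        ≡.subst (a x ℕ.+ i ℕ.* suc (u x) ℕ.≤_) (a+Ld≡w x)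
          (ℕ.+-monoʳ-≤ (a x) (ℕ.*-monoˡ-≤ (suc (u x)) i≤L)) ,
        eq

      P⊆V : ∀ x → P x ⊆ initialSegment n
      P⊆V x y∈P with within x y∈P
      ... | m , _ , m≤w , eq = fromℕ< m<n , trans (reflexive (≡.cong ι (Fin.toℕ-fromℕ< m<n))) eq
        where m<n = ℕ.≤-<-trans m≤w (w<n x)

      -- Both ends of the progression of `x` belong to `P x`, hence to `P y`, whose points lie
      -- between the ends of the progression of `y`.
      nested : ∀ x y → P x ⊆ P y → a y ℕ.≤ a x × w x ℕ.≤ w y
      nested x y P⊆ =
        let _ , ay≤m , _ , ιm≈ιax = within y (P⊆ (a∈P x))
            _ , _ , m≤wy , ιm≈ιwx = within y (P⊆ (w∈P x)) in
        ≡.subst (a y ℕ.≤_) (ι-injective ιm≈ιax) ay≤m , ≡.subst (ℕ._≤ w y) (ι-injective ιm≈ιwx) m≤wy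

      P-injective : Injective _≡_ _≐_ P
      P-injective {x} {y} (P⊆ , ⊆P) = Fin.toℕ-injective
        (≡.trans (≡.sym (cell≡ x)) (≡.trans (≡.cong₂ (λ w u → ∑< w (ℕ._/ L) ℕ.+ u) w≡ u≡) (cell≡ y)))
        where
        cell≡ : ∀ x → ∑< (w x) (ℕ._/ L) ℕ.+ u x ≡ toℕ x
        cell≡ x = proj₂ (proj₂ (proj₂ (proj₂ (cell x))))
        open ≡.≡-Reasoning
        xy = nested x y P⊆
        yx = nested y x ⊆P
        w≡ : w x ≡ w y
        w≡ = ℕ.≤-antisym (proj₂ xy) (proj₂ yx)
        a≡ : a x ≡ a y
        a≡ = ℕ.≤-antisym (proj₁ yx) (proj₁ xy)
        -- Mutual inclusion has fixed both ends; the length `L * (u + 1)` between them then fixes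
        -- the difference.
        u≡ : u x ≡ u y
        u≡ = ℕ.suc-injective (ℕ.*-cancelˡ-≡ (suc (u x)) (suc (u y)) L
          (ℕ.+-cancelˡ-≡ (a x) (L ℕ.* suc (u x)) (L ℕ.* suc (u y)) (begin
            a x ℕ.+ L ℕ.* suc (u x) ≡⟨ a+Ld≡w x ⟩
            w x                     ≡⟨ w≡ ⟩
            w y                     ≡⟨ a+Ld≡w y ⟨
            a y ℕ.+ L ℕ.* suc (u y) ≡⟨ ≡.cong (ℕ._+ L ℕ.* suc (u y)) a≡ ⟨
            a x ℕ.+ L ℕ.* suc (u y) ∎)))

  upper-bound : ∀ {K 𝒫} .{{_ : NonZero K}} (c : CommensurablePattern (suc K) 𝒫) →
    ∀ {n} {V : ℝ-Set} → HasCardinality V n → ∀ {M} (P : Vector ℝ-Set M) → Injective _≡_ _≐_ P →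
    (∀ x → P x ⊆ V × P x ∈ 𝒫) → M ℕ.≤ ∑< n (ℕ._/ K)
  upper-bound {K} c {n} {V} (v , v-inj , V⊆ , _) {M} P P-inj P-in =
    Blocks.family-bound K n g g-increasing (λ x j → rank<n v (p∈V x j)) separated
    where
    open CommensurablePattern c
    sorted = sorted-enumeration (proj₁ P₀-cardinality) (proj₁ (proj₂ P₀-cardinality))
    t = proj₁ sorted
    t∈P₀ : ∀ j → t j ∈ P₀
    t∈P₀ j = proj₂ (proj₂ (proj₂ P₀-cardinality)) (proj₂ (proj₂ sorted) j)
    t-step : ∀ j → t (inject₁ j) < t (suc j)
    t-step j = proj₁ (proj₂ sorted) (s≤s (ℕ.≤-reflexive (Fin.toℕ-inject₁ j)))

    similarity : ∀ x → P x ∈ DirectlySimilarTo P₀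
    similarity x = proj₁ generates (proj₂ (P-in x))
    a b : Fin M → Carrier
    a x = proj₁ (similarity x)
    b x = proj₁ (proj₂ (similarity x))
    0<a : ∀ x → 0# < a x
    0<a x = proj₁ (proj₂ (proj₂ (similarity x)))
    P≐Image : ∀ x → P x ≐ Image (a x) (b x) P₀
    P≐Image x = proj₂ (proj₂ (proj₂ (similarity x)))

    p : Fin M → Fin (suc K) → Carrier
    p x j = a x * t j + b x
    p∈V : ∀ x j → Range v (p x j)
    p∈V x j = V⊆ (proj₁ (P-in x) (proj₂ (P≐Image x) (t j , t∈P₀ j , refl)))

    g : Fin M → Fin (suc K) → ℕ
    g x j = rank v (p x j)
    g-increasing : ∀ x j → g x (inject₁ j) ℕ.< g x (suc j)
    g-increasing x j = rank-strict v (p∈V x (inject₁ j)) (affine-< (b x) (0<a x) (t-step j))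

    separated : ∀ x y j → g x (inject₁ j) ≡ g y (inject₁ j) → g x (suc j) ≡ g y (suc j) → x ≡ y
    separated x y j eq₁ eq₂ =
      let a≈ , b≈ = affine-unique (t-step j)
            (rank-injective v (p∈V x _) (p∈V y _) eq₁) (rank-injective v (p∈V x _) (p∈V y _) eq₂) in
      P-inj (≐-trans (P≐Image x)
        (≐-trans (Image-cong a≈ b≈ , Image-cong (sym a≈) (sym b≈)) (≐-sym (P≐Image y))))

  -- The maximum is taken twice. First the copies found in the initial segment are extended to all
  -- copies there, which gives one attained value above the lower sum. Then the greatest value
  -- attained by any set of `n` points exists, as all of them lie below the upper sum.
  count : ∀ {K L 𝒫} .{{_ : NonZero K}} .{{_ : NonZero L}} (c : CommensurablePattern (suc K) 𝒫) →
          HasEnvelopingPattern𝒜 c (suc L) → ∀ n →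
          ∃[ m ] IsS𝒫 𝒫 n m × ∑< n (ℕ._/ L) ℕ.≤ m × m ℕ.≤ ∑< n (ℕ._/ K)
  count {K} {L} {𝒫} c (A , env) n =
    let m₁ , lower , m₁-count = extend-to-enumeration (≐-setoid Carrier 0ℓ)
          (λ P → P ⊆ V × P ∈ 𝒫) (λ P≐Q (P⊆V , P∈𝒫) → P⊆V ∘ proj₂ P≐Q , 𝒫-resp c P≐Q P∈𝒫)
          (∑< n (ℕ._/ K)) (upper-bound c V-card) P P-inj P-in
        m , m₁≤m , attained , max = maximum Attained (∑< n (ℕ._/ K)) bounded (V , V-card , m₁-count)
    in m , (attained , λ W m′ W-card S → max m′ (W , W-card , S)) ,
       ℕ.≤-trans lower m₁≤m , bounded m attained
    where
    family = lower-family c env n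
    P = proj₁ family
    P-inj = proj₁ (proj₂ family)
    P-in = proj₂ (proj₂ family)
    V = initialSegment c n
    V-card : HasCardinality V n
    V-card = (λ i → ι (toℕ i)) , (Fin.toℕ-injective ∘ ι-injective) , ≐-refl
    Attained : ℕ → Set₁
    Attained m = ∃[ V ] HasCardinality V n × IsS𝒫V 𝒫 V m
    bounded : ∀ m → Attained m → m ℕ.≤ ∑< n (ℕ._/ K)
    bounded m (W , W-card , Q , Q-inj , _ , ⊆C) = upper-bound c W-card Q Q-inj (λ x → ⊆C (x , ≐-refl))

-- The two bounds as rational inequalities

open import Data.Integer using (+_; _+_; _-_; _*_)
open import Data.Rational using (_/_; _≤_)

mainTheorem12 :
  ExcludedMiddle (lsuc 0ℓ) →
  (ℝ : CompleteOrderedField) →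
  let open Patterns ℝ in
  (k : ℕ) (1<k : 1 ℕ.< k) →
  (𝒫 : Pred ℝ-Set 0ℓ) (c : CommensurablePattern k 𝒫) →
  (ℓ : ℕ) (env : HasEnvelopingPattern𝒜 c ℓ) →
  (n : ℕ) → .{{_ : NonZero n}} →
  let instance
        k-1≢0     = pred-nonZero 1<k
        2[k-1]≢0  = double-pred-nonZero 1<k
        ℓ-1≢0     = pred-nonZero (1<ℓ 1<k c env)
        2[ℓ-1]≢0  = double-pred-nonZero (1<ℓ 1<k c env)
      r = n % (k ∸ 1)
      s = n % (ℓ ∸ 1)
  in
  ∃[ m ] IsS𝒫 𝒫 n m
       × ((+ n - + s) * (+ n + + s - + ℓ + + 1)) / (2 ℕ.* (ℓ ∸ 1)) ≤ + m / 1
       × + m / 1 ≤ ((+ n - + r) * (+ n + + r - + k + + 1)) / (2 ℕ.* (k ∸ 1))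
mainTheorem12 em ℝ (suc K) 1<k@(s≤s (s≤s _)) 𝒫 c ℓ env n = bounds ℓ env (1<ℓ 1<k c env)
  where
  open Patterns ℝ
  open PatternCounts em ℝ
  -- The proof of `1 < ℓ` is made a variable so that it can be matched; `ℓ ∸ 1` then computes to
  -- `L`, and the divisors take the form used in `count`.
  bounds : ∀ ℓ → HasEnvelopingPattern𝒜 c ℓ → (1<ℓ : 1 ℕ.< ℓ) →
           let instance
                 ℓ-1≢0    = pred-nonZero 1<ℓ
                 2[ℓ-1]≢0 = double-pred-nonZero 1<ℓ
               r = n % K
               s = n % (ℓ ∸ 1)
           in
           ∃[ m ] IsS𝒫 𝒫 n m
                × ((+ n - + s) * (+ n + + s - + ℓ + + 1)) / (2 ℕ.* (ℓ ∸ 1)) ≤ + m / 1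
                × + m / 1 ≤ ((+ n - + r) * (+ n + + r - + suc K + + 1)) / (2 ℕ.* K)
  bounds (suc L) env (s≤s (s≤s _)) =
    let m , S≡m , lower , upper = count c env n in
    m , S≡m
      , ≡.subst (_≤ + m / 1) (≡.sym ([n-r][n+r-K]/2K≡∑ L n)) (/1-mono-≤ lower)
      , ≡.subst (+ m / 1 ≤_) (≡.sym ([n-r][n+r-K]/2K≡∑ K n)) (/1-mono-≤ upper)
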